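{- Let $(\mathcal{I},\gamma)$ be an inference system with coaxioms on a universe $\mathcal{U}$, and let $j\in\mathcal{U}$. Then the following are equivalent: (1) $j\in\mathit{Gen}(\mathcal{I},\gamma)$; (2) there exists a proof tree $t$ for $j$ in $\mathcal{I}$ such that each node of $t$ has a well-founded proof tree in $\mathcal{I}_{\sqcup\gamma}$ (i.e. for each $\alpha\in\mathit{dom}(t)$ there is a well-founded proof tree for the judgement $t(\alpha)$ in $\mathcal{I}_{\sqcup\gamma}$).
   Context: Inference systems. Fix a set $\mathcal{U}$ (the universe), whose elements are called judgements. An inference system $\mathcal{I}$ is a set of rules, i.e. pairs $\frac{Pr}{c}$ with $Pr\subseteq\mathcal{U}$ (premises, an arbitrary set) and $c\in\mathcal{U}$ (conclusion). Its inference operator is $F_{\mathcal{I}}:\wp(\mathcal{U})\to\wp(\mathcal{U})$, $F_{\mathcal{I}}(S)=\{c \mid \exists \frac{Pr}{c}\in\mathcal{I},\ Pr\subseteq S\}$. $\mathit{Ind}(\mathcal{I})$ and $\mathit{CoInd}(\mathcal{I})$ are the least and the greatest fixed point of $F_{\mathcal{I}}$. An inference system with coaxioms is a pair $(\mathcal{I},\gamma)$ with $\mathcal{I}$ an inference system and $\gamma\subseteq\mathcal{U}$. $\mathcal{I}_{\sqcup\gamma}=\mathcal{I}\cup\{\frac{\emptyset}{c}\mid c\in\gamma\}$; for $S\subseteq\mathcal{U}$, $\mathcal{I}_{\sqcap S}=\{\frac{Pr}{c}\in\mathcal{I}\mid c\in S\}$. The interpretation generated by coaxioms is $\mathit{Gen}(\mathcal{I},\gamma)=\mathit{CoInd}(\mathcal{I}_{\sqcap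 \mathit{Ind}(\mathcal{I}_{\sqcup\gamma})})$. Trees. For a set $A$, $A^\star$ is the set of finite strings over $A$, $\varepsilon$ the empty string. A tree language is a non-empty $L\subseteq A^\star$ such that $\alpha a\in L$ implies $\alpha\in L$ ($a\in A$). A tree labelled in a set $\Lambda$ is a function $t:L\to\Lambda$ with $L=\mathit{dom}(t)$ a tree language; its root is $t(\varepsilon)$; its nodes are the elements of $\mathit{dom}(t)$. For $\alpha\in\mathit{dom}(t)$, $\mathit{chl}_t(\alpha)=\{\alpha a\in \mathit{dom}(t)\mid a\in A\}$. $t$ is well-founded if every subset of $\mathit{dom}(t)$ that is a chain for the prefix order is finite. $t$ is children injective if $t$ restricted to $\mathit{chl}_t(\alpha)$ is injective for all $\alpha\in\mathit{dom}(t)$. Children injective trees labelled in $\Lambda$ are considered up to renaming of alphabet symbols and can be taken in canonical form: $A=\Lambda$ and $t(\alpha a)=a$ for all $\alpha a\in\mathit{dom}(t)$. Proof trees. A proof tree in $\mathcal{I}$ is a children injective tree $t$ labelled in $\mathcal{U}$ such that for all $\alpha\in\mathit{dom}(t)$ there is a rule $\frac{Pr}{c}\in\mathcal{I}$ with $t(\alpha)=c$ and $t(\mathit{chl}_t(\alpha))=Pr$. It is a proof tree for $j$ if $t(\varepsilon)=j$. -}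

module Defs where

open import Level using (Level; suc; _⊔_)
open import Data.List using (List; []; _∷ʳ_)
open import Data.List.Membership.Propositional using () renaming (_∈_ to _∈ₗ_)
open import Data.List.Relation.Binary.Prefix.Heterogeneous using (Prefix)
open import Data.List.Reverse using (Reverse; []; _∶_∶ʳ_; reverseView)
open import Data.Nat using (ℕ; zero) renaming (suc to 1+_)
open import Data.Product using (Σ-syntax; ∃; ∃-syntax; _×_; _,_; proj₁; proj₂)
open import Data.Sum using (_⊎_)
open import Data.Unit.Polymorphic using (⊤; tt)
open import Relation.Binary.PropositionalEquality using (_≡_; refl; cong)
open import Relation.Unary using (Pred; _∈_; _⊆_; _≐_; _∪_; _∩_; ∅; Satisfiable)

-- All subsets, in particular sets of premises, are predicates and are
-- compared extensionally (_≐_). Sets of rules may live one level higher, as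
-- they are families of pairs whose first component is itself a subset.

Rule : ∀ {ℓ} → Set ℓ → Set (suc ℓ)
Rule {ℓ} 𝒰 = Pred 𝒰 ℓ × 𝒰

InferenceSystem : ∀ {ℓ} → Set ℓ → Set (suc (suc ℓ))
InferenceSystem {ℓ} 𝒰 = Pred (Rule 𝒰) (suc ℓ)

module _ {ℓ} {𝒰 : Set ℓ} where

  F : ∀ {s} → InferenceSystem 𝒰 → Pred 𝒰 s → Pred 𝒰 (suc ℓ ⊔ s)
  F I S c = ∃[ Pr ] (Pr , c) ∈ I × Pr ⊆ S

  data Ind (I : InferenceSystem 𝒰) : Pred 𝒰 (suc ℓ) where
    fold : ∀ {c} → c ∈ F I (Ind I) → Ind I c

  -- The union of all post-fixed points of F I. The lemmas below show that it
  -- is a fixed point and contains post-fixed points at every universe level.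

  CoInd : InferenceSystem 𝒰 → Pred 𝒰 (suc ℓ)
  CoInd I j = Σ[ S ∈ Pred 𝒰 ℓ ] S ⊆ F I S × j ∈ S

  infixl 6 _⊔ᶜ_ _⊓ᶜ_

  _⊔ᶜ_ : InferenceSystem 𝒰 → Pred 𝒰 ℓ → InferenceSystem 𝒰
  I ⊔ᶜ γ = I ∪ λ (Pr , c) → Pr ≐ ∅ × c ∈ γ

  _⊓ᶜ_ : InferenceSystem 𝒰 → Pred 𝒰 (suc ℓ) → InferenceSystem 𝒰
  I ⊓ᶜ S = I ∩ λ (Pr , c) → c ∈ S

  Gen : InferenceSystem 𝒰 → Pred 𝒰 ℓ → Pred 𝒰 (suc ℓ)
  Gen I γ = CoInd (I ⊓ᶜ Ind (I ⊔ᶜ γ))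

  module _ (I : InferenceSystem 𝒰) where

    F-mono : ∀ {s s′} {S : Pred 𝒰 s} {S′ : Pred 𝒰 s′} → S ⊆ S′ → F I S ⊆ F I S′
    F-mono S⊆S′ (Pr , r , Pr⊆S) = Pr , r , λ a∈Pr → S⊆S′ (Pr⊆S a∈Pr)

    Ind-least : ∀ {s} {S : Pred 𝒰 s} → F I S ⊆ S → Ind I ⊆ S
    Ind-least FS⊆S (fold (Pr , r , Pr⊆Ind)) =
      FS⊆S (Pr , r , λ a∈Pr → Ind-least FS⊆S (Pr⊆Ind a∈Pr))

    Ind-fixed : F I (Ind I) ≐ Ind I
    Ind-fixed = fold , λ { (fold x) → x }

    -- A post-fixed point S at an arbitrary level need not be a Pred 𝒰 ℓ, but
    -- the judgements reachable from a given element of S always form one.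

    private
      module Reach {s} {S : Pred 𝒰 s} (S⊆FS : S ⊆ F I S) where

        Path : ℕ → ∀ {c} → c ∈ S → Set ℓ
        Path zero   x = ⊤
        Path (1+ n) x = let (Pr , _ , Pr⊆S) = S⊆FS x in
          ∃[ a ] Σ[ a∈Pr ∈ a ∈ Pr ] Path n (Pr⊆S a∈Pr)

        end : ∀ n {c} (x : c ∈ S) → Path n x → ∃ S
        end zero   x _           = _ , x
        end (1+ n) x (_ , _ , π) = end n _ π

        snoc : ∀ n {c} (x : c ∈ S) (π : Path n x) →
               let (Pr , _ , Pr⊆S) = S⊆FS (proj₂ (end n x π)) in
               ∀ {a} (a∈Pr : a ∈ Pr) →
               Σ[ π′ ∈ Path (1+ n) x ] end (1+ n) x π′ ≡ (a , Pr⊆S a∈Pr)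
        snoc zero   x _              a∈Pr = (_ , a∈Pr , tt) , refl
        snoc (1+ n) x (b , b∈Pr , π) a∈Pr =
          let (π′ , eq) = snoc n _ π a∈Pr in (b , b∈Pr , π′) , eq

        Reachable : ∀ {c} → c ∈ S → Pred 𝒰 ℓ
        Reachable x j = ∃[ n ] Σ[ π ∈ Path n x ] proj₁ (end n x π) ≡ j

        Reachable-post : ∀ {c} (x : c ∈ S) → Reachable x ⊆ F I (Reachable x)
        Reachable-post x (n , π , refl) =
          let (Pr , r , _) = S⊆FS (proj₂ (end n x π)) in
          Pr , r , λ a∈Pr → 1+ n , step a∈Pr
          where
          step : ∀ {a} → a ∈ proj₁ (S⊆FS (proj₂ (end n x π))) →
                 Σ[ π′ ∈ Path (1+ n) x ] proj₁ (end (1+ n) x π′) ≡ a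
          step a∈Pr = let (π′ , eq) = snoc n x π a∈Pr in π′ , cong proj₁ eq

    CoInd-greatest : ∀ {s} {S : Pred 𝒰 s} → S ⊆ F I S → S ⊆ CoInd I
    CoInd-greatest S⊆FS x = Reachable x , (λ {c} → Reachable-post x {c}) , zero , tt , refl
      where open Reach S⊆FS

    CoInd-post : CoInd I ⊆ F I (CoInd I)
    CoInd-post (S , S⊆FS , x) =
      F-mono {S = S} {S′ = CoInd I} (λ y → S , (λ {c} → S⊆FS {c}) , y) (S⊆FS x)

    CoInd-fixed : F I (CoInd I) ≐ CoInd I
    CoInd-fixed = CoInd-greatest (F-mono {S = CoInd I} CoInd-post) , CoInd-post

record IsTreeLanguage {ℓ} {A : Set ℓ} (L : Pred (List A) ℓ) : Set ℓ where
  field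
    nonEmpty     : Satisfiable L
    prefixClosed : ∀ {α a} → α ∷ʳ a ∈ L → α ∈ L

  ε∈ : [] ∈ L
  ε∈ = let (α , α∈L) = nonEmpty in go (reverseView α) α∈L
    where
    go : ∀ {α} → Reverse α → α ∈ L → [] ∈ L
    go []            p = p
    go (_ ∶ rs ∶ʳ _) p = go rs (prefixClosed p)

-- Trees are considered up to renaming of the symbols, so the alphabet is a
-- field rather than a parameter. The labelling is defined on dom only; label-irr makes it a function of the
-- string rather than of the proof that the string is a node.

record Tree {ℓ} (Λ : Set ℓ) : Set (suc ℓ) where
  field
    Alphabet  : Set ℓ
    dom       : Pred (List Alphabet) ℓ
    isLang    : IsTreeLanguage dom
    label     : ∀ {α} → α ∈ dom → Λ
    label-irr : ∀ {α} (p q : α ∈ dom) → label p ≡ label q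

  root : Λ
  root = label (IsTreeLanguage.ε∈ isLang)

  chl : List Alphabet → Pred (List Alphabet) ℓ
  chl α β = β ∈ dom × ∃[ a ] β ≡ α ∷ʳ a

  image : Pred (List Alphabet) ℓ → Pred Λ ℓ
  image S x = ∃[ α ] α ∈ S × Σ[ p ∈ α ∈ dom ] label p ≡ x

  ChildrenInjective : Set ℓ
  ChildrenInjective = ∀ {α} → α ∈ dom → ∀ {β β′} → β ∈ chl α → β′ ∈ chl α →
    (p : β ∈ dom) (p′ : β′ ∈ dom) → label p ≡ label p′ → β ≡ β′

  IsChain : Pred (List Alphabet) ℓ → Set ℓ
  IsChain S = ∀ {α β} → α ∈ S → β ∈ S → Prefix _≡_ α β ⊎ Prefix _≡_ β α

  Finite : Pred (List Alphabet) ℓ → Set ℓ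
  Finite S = ∃[ αs ] S ≐ (_∈ₗ αs)

  WellFounded : Set (suc ℓ)
  WellFounded = ∀ S → S ⊆ dom → IsChain S → Finite S

record IsProofTree {ℓ} {𝒰 : Set ℓ} (I : InferenceSystem 𝒰) (t : Tree 𝒰) : Set (suc ℓ) where
  open Tree t
  field
    childrenInjective : ChildrenInjective
    justified : ∀ {α} (p : α ∈ dom) →
      ∃[ Pr ] ∃[ c ] (Pr , c) ∈ I × label p ≡ c × image (chl α) ≐ Pr

IsProofTreeFor : ∀ {ℓ} {𝒰 : Set ℓ} → InferenceSystem 𝒰 → 𝒰 → Tree 𝒰 → Set (suc ℓ)
IsProofTreeFor I j t = IsProofTree I t × Tree.root t ≡ j

{-# OPTIONS --safe #-}

-- A post-fixed point of F I assigns to each of its elements a rule with premises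
-- in the same set, so its elements unfold to proof trees. Unfolding a witness of
-- Gen gives the outer tree, unfolding derivations in Ind gives the well-founded
-- ones. Conversely, the labels of a proof tree form a post-fixed point, and a tree
-- whose root is not in Ind has an infinite branch of labels outside Ind. No choice
-- beyond excluded middle is needed, since Dec picks a witness of each inhabited type.

module Submission where

open import Defs
open import Level using (suc; Lift; lift; lower)
open import Axiom.ExcludedMiddle using (ExcludedMiddle)
open import Data.Empty using (⊥-elim)
open import Data.List using (List; []; _∷_; _∷ʳ_; length; map)
open import Data.List.Extrema.Nat using (max; xs≤max)
open import Data.List.Membership.Propositional using () renaming (_∈_ to _∈ₗ_)
open import Data.List.Membership.Propositional.Properties using (∈-map⁺; ∈-map⁻)
open import Data.List.Properties using (length-++-comm)
open import Data.List.Relation.Binary.Prefix.Heterogeneous using (Prefix; []; _∷_; tail; _++ᵖ_)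
open import Data.List.Relation.Binary.Prefix.Heterogeneous.Properties as Prefix using ()
open import Data.List.Relation.Binary.Pointwise as Pointwise using ()
open import Data.List.Relation.Unary.All using (lookup)
open import Data.List.Relation.Unary.Any using (here; there)
open import Data.Nat using (ℕ; zero; _≤_; _≤′_; ≤′-refl; ≤′-step) renaming (suc to 1+_)
open import Data.Nat.Properties using (≤-total; ≤⇒≤′; 1+n≰n)
open import Data.Product using (Σ-syntax; ∃; ∃-syntax; _×_; _,_; proj₁; proj₂)
open import Data.Sum as Sum using (inj₁; inj₂)
open import Data.Unit.Polymorphic using (⊤; tt)
open import Function.Bundles using (_⇔_; mk⇔)
open import Relation.Binary.PropositionalEquality using (_≡_; refl; sym; trans; cong; subst)
open import Relation.Nullary using (¬_; Dec; yes; no; recompute)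
open import Relation.Nullary.Decidable using (map′; decidable-stable)
open import Relation.Unary using (Pred; _∈_; _∉_; _⊆_; _≐_)
open Tree using (dom; label; WellFounded)

module _ {ℓ} (em : ExcludedMiddle (suc ℓ)) where

  -- Domains and premise sets live one level below `Ind`; lifting brings them within reach of `em`.
  em↓ : {P : Set ℓ} → Dec P
  em↓ = map′ lower lift (em {Lift (suc ℓ) _})

  nonroot-finite⇒finite : {A : Set ℓ} (S : Pred (List A) ℓ) (βs : List (List A)) →
    (∀ {a α} → a ∷ α ∈ S → a ∷ α ∈ₗ βs) → (_∈ₗ βs) ⊆ S → ∃[ αs ] S ≐ (_∈ₗ αs)
  nonroot-finite⇒finite S βs ⊆βs βs⊆ with em↓ {[] ∈ S}
  ... | yes ε∈S = [] ∷ βs ,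
    (λ { {[]} _ → here refl ; {_ ∷ _} s → there (⊆βs s) }) ,
    (λ { (here refl) → ε∈S ; (there i) → βs⊆ i })
  ... | no ε∉S = βs ,
    (λ { {[]} s → ⊥-elim (ε∉S s) ; {_ ∷ _} s → ⊆βs s }) ,
    βs⊆

  module _ {𝒰 : Set ℓ} where

    module Unfold {s} {I : InferenceSystem 𝒰} {T : Pred 𝒰 s} (post : T ⊆ F I T) where

      premises : ∀ {c} → c ∈ T → Pred 𝒰 ℓ
      premises x = proj₁ (post x)

      -- As recompute ignores its argument, step does not depend on the proof of
      -- a ∈ premises x; otherwise a child could carry several subtrees.
      step : ∀ {c} (x : c ∈ T) {a} → a ∈ premises x → a ∈ T
      step x a∈Pr = proj₂ (proj₂ (post x)) (recompute em↓ a∈Pr)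

      -- The canonical form of a children injective tree: each symbol is the label of the child it
      -- leads to. Only premise sets are mentioned, so the level is ℓ even when `T` is `Ind I`.
      Dom : ∀ {c} → c ∈ T → Pred (List 𝒰) ℓ
      Dom x []      = ⊤
      Dom x (a ∷ α) = Σ[ p ∈ a ∈ premises x ] Dom (step x p) α

      lastFrom : 𝒰 → List 𝒰 → 𝒰
      lastFrom c []      = c
      lastFrom c (a ∷ α) = lastFrom a α

      lastFrom-∷ʳ : ∀ c α {a} → lastFrom c (α ∷ʳ a) ≡ a
      lastFrom-∷ʳ c []      = refl
      lastFrom-∷ʳ c (b ∷ α) = lastFrom-∷ʳ b α

      end : ∀ {c} (x : c ∈ T) {α} → α ∈ Dom x → lastFrom c α ∈ T
      end x {[]}    _       = x
      end x {a ∷ α} (p , d) = end (step x p) d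

      Dom-prefix : ∀ {c} (x : c ∈ T) α {a} → α ∷ʳ a ∈ Dom x → α ∈ Dom x
      Dom-prefix x []      _       = tt
      Dom-prefix x (b ∷ α) (p , d) = p , Dom-prefix (step x p) α d

      Dom-∷ʳ⁺ : ∀ {c} (x : c ∈ T) α {a} (d : α ∈ Dom x) →
                a ∈ premises (end x d) → α ∷ʳ a ∈ Dom x
      Dom-∷ʳ⁺ x []      _       q = q , tt
      Dom-∷ʳ⁺ x (b ∷ α) (p , d) q = p , Dom-∷ʳ⁺ (step x p) α d q

      Dom-∷ʳ⁻ : ∀ {c} (x : c ∈ T) α {a} (d : α ∈ Dom x) →
                α ∷ʳ a ∈ Dom x → a ∈ premises (end x d)
      Dom-∷ʳ⁻ x []      _       (q , _) = q
      -- The discarded proof may differ from `p`, but `step` sends both to definitionally the same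
      -- element.
      Dom-∷ʳ⁻ x (b ∷ α) (p , d) (_ , e) = Dom-∷ʳ⁻ (step x p) α d e

      tree : ∀ {c} → c ∈ T → Tree 𝒰
      tree {c} x = record
        { Alphabet  = 𝒰
        ; dom       = Dom x
        ; isLang    = record
          { nonEmpty     = [] , tt
          ; prefixClosed = λ {α} → Dom-prefix x α
          }
        ; label     = λ {α} _ → lastFrom c α
        ; label-irr = λ _ _ → refl
        }

      tree-isProofTreeFor : ∀ {c} (x : c ∈ T) → IsProofTreeFor I c (tree x)
      tree-isProofTreeFor {c} x = record
        { childrenInjective = λ {α} _ → λ
          { (_ , a , refl) (_ , b , refl) _ _ eq →
            cong (α ∷ʳ_) (trans (sym (lastFrom-∷ʳ c α)) (trans eq (lastFrom-∷ʳ c α))) }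
        ; justified = λ {α} d →
            premises (end x d) , lastFrom c α , proj₁ (proj₂ (post (end x d))) , refl ,
            (λ { (_ , (e , a , refl) , _ , refl) →
                 subst (_∈ premises (end x d)) (sym (lastFrom-∷ʳ c α)) (Dom-∷ʳ⁻ x α d e) }) ,
            (λ {a} q → let e = Dom-∷ʳ⁺ x α d q in
                 α ∷ʳ a , (e , a , refl) , e , lastFrom-∷ʳ c α)
        } , refl

    module _ {I : InferenceSystem 𝒰} where

      open Unfold {I = I} {T = Ind I} (proj₂ (Ind-fixed I)) using (Dom; tree)

      -- The non-empty strings of a chain share their first symbol, so their tails
      -- form a chain in the tree of a single subderivation.
      Dom-chain-finite : ∀ {c} (x : c ∈ Ind I) (S : Pred (List 𝒰) ℓ) → S ⊆ Dom x →
                         Tree.IsChain (tree x) S → Tree.Finite (tree x) S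
      Dom-chain-finite (fold (Pr , r , sub)) S S⊆ chain
        with em↓ {∃[ a ] ∃[ α ] a ∷ α ∈ S}
      ... | no none =
        nonroot-finite⇒finite S [] (λ s → ⊥-elim (none (_ , _ , s))) (λ ())
      ... | yes (a , α₀ , a∷α₀∈S) =
        nonroot-finite⇒finite S (map (a ∷_) αs) nonroot⁺ nonroot⁻
        where
        tails-finite : ∃[ αs ] (λ α → a ∷ α ∈ S) ≐ (_∈ₗ αs)
        -- `recompute` mirrors `step`, so one subderivation serves every string of `S` that begins
        -- with `a`.
        tails-finite = Dom-chain-finite (sub (recompute em↓ (proj₁ (S⊆ a∷α₀∈S))))
          (λ α → a ∷ α ∈ S) (λ s → proj₂ (S⊆ s)) (λ s s′ → Sum.map tail tail (chain s s′))

        αs = proj₁ tails-finite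

        nonroot⁺ : ∀ {b β} → b ∷ β ∈ S → b ∷ β ∈ₗ map (a ∷_) αs
        nonroot⁺ s with chain s a∷α₀∈S
        ... | inj₁ (refl ∷ _) = ∈-map⁺ (a ∷_) (proj₁ (proj₂ tails-finite) s)
        ... | inj₂ (refl ∷ _) = ∈-map⁺ (a ∷_) (proj₁ (proj₂ tails-finite) s)

        nonroot⁻ : ∀ {β} → β ∈ₗ map (a ∷_) αs → β ∈ S
        nonroot⁻ i with ∈-map⁻ (a ∷_) i
        ... | _ , α∈αs , refl = proj₂ (proj₂ tails-finite) α∈αs

      Ind⇒wellFoundedTree : ∀ {c} → c ∈ Ind I → ∃[ t ] IsProofTreeFor I c t × WellFounded t
      Ind⇒wellFoundedTree x = tree x ,
        Unfold.tree-isProofTreeFor {I = I} {T = Ind I} (proj₂ (Ind-fixed I)) x ,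
        Dom-chain-finite x

      module _ {t : Tree 𝒰} (proof : IsProofTree I t) (wf : WellFounded t) where
        open Tree t using (Alphabet)
        open IsProofTree proof

        Bad : Pred (List Alphabet) (suc ℓ)
        Bad α = Σ[ p ∈ α ∈ dom t ] label t p ∉ Ind I

        -- Were no child bad, the rule justifying the node would derive its label from labels in
        -- `Ind I`.
        bad-child : ∀ {α} → α ∈ Bad → ∃[ a ] α ∷ʳ a ∈ Bad
        bad-child {α} (p , ∉Ind) = decidable-stable em λ none →
          let (Pr , c , r , eq , _ , Pr⊆) = justified p in
          ∉Ind (subst (Ind I) (sym eq) (fold (Pr , r , λ x∈Pr → child∈Ind none (Pr⊆ x∈Pr))))
          where
          child∈Ind : ¬ (∃[ a ] α ∷ʳ a ∈ Bad) → Tree.image t (Tree.chl t α) ⊆ Ind I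
          child∈Ind none (_ , (_ , a , refl) , q , refl) =
            decidable-stable em λ ∉Ind → none (a , q , ∉Ind)

        module _ (bad-root : [] ∈ Bad) where

          branch : ℕ → ∃ Bad
          branch zero   = [] , bad-root
          branch (1+ n) = let (_ , bad) = branch n in _ , proj₂ (bad-child bad)

          node : ℕ → List Alphabet
          node n = proj₁ (branch n)

          length-node : ∀ n → length (node n) ≡ n
          length-node zero   = refl
          length-node (1+ n) = trans (length-++-comm (node n) _) (cong 1+_ (length-node n))

          node-mono : ∀ {m n} → m ≤′ n → Prefix _≡_ (node m) (node n)
          node-mono ≤′-refl       = Prefix.fromPointwise (Pointwise.refl refl)
          node-mono (≤′-step m≤n) = node-mono m≤n ++ᵖ _

          -- A finite list bounds the lengths of its strings, and the node one level below that
          -- bound is too long to occur in it.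
          branch-infinite : ¬ Tree.Finite t (λ α → ∃[ n ] node n ≡ α)
          branch-infinite (αs , ⊆αs , _) = 1+n≰n (subst (_≤ bound) (length-node (1+ bound))
            (lookup (xs≤max 0 (map length αs)) (∈-map⁺ length (⊆αs (1+ bound , refl)))))
            where bound = max 0 (map length αs)

          branch-chain : Tree.IsChain t (λ α → ∃[ n ] node n ≡ α)
          branch-chain (m , refl) (n , refl) =
            Sum.map (λ m≤n → node-mono (≤⇒≤′ m≤n)) (λ n≤m → node-mono (≤⇒≤′ n≤m)) (≤-total m n)

        root∉Bad : [] ∉ Bad
        root∉Bad bad-root = branch-infinite bad-root
          (wf _ (λ { (n , refl) → proj₁ (proj₂ (branch bad-root n)) }) (branch-chain bad-root))

        wellFounded⇒root∈Ind : Tree.root t ∈ Ind I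
        wellFounded⇒root∈Ind = decidable-stable em λ root∉Ind → root∉Bad (_ , root∉Ind)

corollary4p7 : ∀ {ℓ} → ExcludedMiddle (suc ℓ) →
    (𝒰 : Set ℓ) (I : InferenceSystem 𝒰) (γ : Pred 𝒰 ℓ) (j : 𝒰) →
    j ∈ Gen I γ ⇔
    (∃[ t ] IsProofTreeFor I j t ×
    (∀ {α} (p : α ∈ dom t) →
    ∃[ s ] IsProofTreeFor (I ⊔ᶜ γ) (label t p) s × WellFounded s))
corollary4p7 em 𝒰 I γ j = mk⇔ to from
  where
  to : j ∈ Gen I γ → _
  to (S , post , j∈S) = tree j∈S , tree-isProofTreeFor j∈S ,
    -- The restricted rule at a node carries a proof that its conclusion, the label, is derivable
    -- with coaxioms.
    λ {α} d → Ind⇒wellFoundedTree em (proj₂ (proj₁ (proj₂ (post (end j∈S {α} d)))))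
    where
    post′ : S ⊆ F I S
    post′ x = let (Pr , (r , _) , Pr⊆S) = post x in Pr , r , Pr⊆S
    open Unfold em {I = I} {T = S} post′

  from : _ → j ∈ Gen I γ
  from (t , (proof , root≡j) , trees) = labels , labels-post , _ , _ , root≡j
    where
    -- The witness for `CoInd`, which asks for a post-fixed point at level ℓ.
    labels : Pred 𝒰 _
    labels c = ∃[ α ] Σ[ p ∈ α ∈ dom t ] label t p ≡ c

    label∈Ind : ∀ {α} (p : α ∈ dom t) → label t p ∈ Ind (I ⊔ᶜ γ)
    label∈Ind p = let (s , (proof′ , root≡) , wf) = trees p in
      subst (Ind (I ⊔ᶜ γ)) root≡ (wellFounded⇒root∈Ind em proof′ wf)

    -- The premises at a node are labels of its children, and the restriction on the conclusion is
    -- `label∈Ind`.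
    labels-post : labels ⊆ F (I ⊓ᶜ Ind (I ⊔ᶜ γ)) labels
    labels-post (_ , p , refl) with IsProofTree.justified proof p
    ... | Pr , _ , r , refl , _ , Pr⊆ = Pr , (r , label∈Ind p) ,
      λ x∈Pr → let (β , _ , q , eq) = Pr⊆ x∈Pr in β , q , eq
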